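{- Let $\langle A,\to\rangle$ be a conditional algebra. Then the Stone map $\varphi\colon A\to\mathcal{P}(\mathrm{Ul}(A))$, $\varphi(a)=\{u\in\mathrm{Ul}(A): a\in u\}$, is an embedding of $\langle A,\to\rangle$ into $\mathrm{Em}(A)=\langle \mathcal{P}(\mathrm{Ul}(A)),\to_{T_A}\rangle$. That is, $\varphi$ is an injective Boolean homomorphism and $\varphi(a\to b)=\varphi(a)\to_{T_A}\varphi(b)$ for all $a,b\in A$.
   Context: A conditional algebra is a pair $\langle A,\to\rangle$ where $A$ is a Boolean algebra and $\to$ is a binary operation on $A$ such that for all $a,b,c$: $a\to 1=1$; $(a\to b)\wedge(a\to c)=a\to(b\wedge c)$; $(a\vee b)\to c\le (a\to c)\wedge(b\to c)$. Filters of $A$ include the improper filter $A$; $\mathrm{Ul}(A)$ is the set of ultrafilters. For a filter $F$, $\varphi(F)=\{u\in\mathrm{Ul}(A):F\subseteq u\}$ (so $\varphi(A)=\emptyset$). For $X,Y\subseteq A$, $D^{\to}_X(Y)=\{b\in A:\exists a\in Y,\ a\to b\in X\}$. The relation $T_A\subseteq \mathrm{Ul}(A)\times\mathcal{P}(\mathrm{Ul}(A))\times\mathrm{Ul}(A)$ is defined by: $T_A(u,Z,v)$ iff there is a filter $F$ of $A$ with $Z=\varphi(F)$ and $D^{\to}_u(F)\subseteq v$. Write $T_A(u,Z)=\{v: T_A(u,Z,v)\}$. For $U,V\subseteq \mathrm{Ul}(A)$, $U\to_{T_A}V=\{u\in\mathrm{Ul}(A): \text{for all } Z\subseteq U,\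 T_A(u,Z)\subseteq V\}$. -}

module Defs where

open import Algebra.Core using (Op₂)
open import Algebra.Lattice.Bundles using (BooleanAlgebra; RawLattice)
open import Algebra.Lattice.Morphism.Structures using (IsLatticeMonomorphism)
open import Data.Product.Base using (Σ-syntax; ∃-syntax; _×_)
open import Level using (Level; suc; _⊔_)
open import Relation.Unary using (Pred; _∈_; _∉_; _⊆_; _≐_; _∩_; _∪_; ∁; U; ∅)
import Relation.Binary.Construct.NaturalOrder.Left as NaturalOrder

private
  variable
    c ℓ : Level

record ConditionalAlgebra c ℓ : Set (suc (c ⊔ ℓ)) where
  field
    booleanAlgebra : BooleanAlgebra c ℓ

  open BooleanAlgebra booleanAlgebra public

  -- x ≤ y is x ≈ x ∧ y, the order of Algebra.Lattice.Properties.Lattice.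
  open NaturalOrder _≈_ _∧_ public using (_≤_)

  infixr 5 _⇒_
  field
    _⇒_         : Op₂ Carrier
    ⇒-cong      : ∀ {x x′ y y′} → x ≈ x′ → y ≈ y′ → (x ⇒ y) ≈ (x′ ⇒ y′)
    ⇒-⊤         : ∀ x → (x ⇒ ⊤) ≈ ⊤
    ⇒-∧         : ∀ x y z → ((x ⇒ y) ∧ (x ⇒ z)) ≈ (x ⇒ (y ∧ z))
    ∨-⇒         : ∀ x y z → ((x ∨ y) ⇒ z) ≤ ((x ⇒ z) ∧ (y ⇒ z))

module _ (𝐀 : ConditionalAlgebra c ℓ) where
  open ConditionalAlgebra 𝐀

  private
    p : Level
    p = c ⊔ ℓ

  -- Properness is not required: the whole algebra is a filter.
  record IsFilter (F : Pred Carrier p) : Set p where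
    field
      ⊤-mem    : ⊤ ∈ F
      ∧-closed : ∀ {x y} → x ∈ F → y ∈ F → (x ∧ y) ∈ F
      ≤-closed : ∀ {x y} → x ≤ y → x ∈ F → y ∈ F

  record IsProperFilter (F : Pred Carrier p) : Set p where
    field
      isFilter : IsFilter F
      proper   : ⊥ ∉ F

  record IsUltrafilter (F : Pred Carrier p) : Set (suc p) where
    field
      isProperFilter : IsProperFilter F
      maximal        : (G : Pred Carrier p) → IsProperFilter G → F ⊆ G → G ⊆ F

  record Ul : Set (suc p) where
    field
      member        : Pred Carrier p
      isUltrafilter : IsUltrafilter member

  open Ul using (member)

  φ : Carrier → Pred Ul p
  φ a u = a ∈ member u

  φᶠ : Pred Carrier p → Pred Ul p
  φᶠ F u = F ⊆ member u

  D : Pred Carrier p → Pred Carrier p → Pred Carrier p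
  D X Y b = ∃[ a ] (a ∈ Y × (a ⇒ b) ∈ X)

  T : Ul → Pred Ul p → Pred Ul (suc p)
  T u Z v = Σ[ F ∈ Pred Carrier p ] (IsFilter F × Z ≐ φᶠ F × D (member u) F ⊆ member v)

  -- Quantifying over all Z raises the level of the resulting subset; _≐_ compares
  -- subsets of different levels, and under excluded middle every subset is
  -- equivalent to one of level p, so Z ranges over the full power set.
  infixr 5 _⇒ᵀ_
  _⇒ᵀ_ : Pred Ul p → Pred Ul p → Pred Ul (suc p)
  (V ⇒ᵀ W) u = (Z : Pred Ul p) → Z ⊆ V → T u Z ⊆ W

  𝒫-rawLattice : RawLattice (suc p) (suc p)
  𝒫-rawLattice = record
    { Carrier = Pred Ul p
    ; _≈_     = _≐_
    ; _∧_     = _∩_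
    ; _∨_     = _∪_
    }

  record IsEmbedding (f : Carrier → Pred Ul p) : Set (suc p) where
    field
      isLatticeMonomorphism : IsLatticeMonomorphism rawLattice 𝒫-rawLattice f
      ⊤-homo : f ⊤ ≐ U
      ⊥-homo : f ⊥ ≐ ∅
      ¬-homo : ∀ a → f (¬ a) ≐ ∁ (f a)
      ⇒-homo : ∀ a b → f (a ⇒ b) ≐ (f a ⇒ᵀ f b)

{-# OPTIONS --safe #-}

-- Everything rests on separation: a filter F and a ∉ F are separated by an
-- ultrafilter u ⊇ F with a ∉ u. It follows by extending the proper filter
-- {x : a ∨ x ∈ F}, which contains F and ¬ a, to a maximal one. For Zorn's lemma,
-- excluded middle for all types doubles as a choice operator, which picks a proper
-- extension of each non-maximal subset; the tower generated by this choice function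
-- and by unions is a chain (Bourbaki–Witt), and its union is maximal.
--
-- If a ⇒ b ∈ u, φ(F) ⊆ φ(a) and D u F ⊆ v, then a ∈ F by separation, so b ∈ D u F ⊆ v.
-- If a ⇒ b ∉ u, then D u (↑ a) = {x : a ⇒ x ∈ u} is a filter omitting b, and separation
-- yields v with T u (φ(↑ a)) v and b ∉ v.
module Submission where

open import Defs
open import Axiom.ExcludedMiddle using (ExcludedMiddle)
open import Axiom.Extensionality.Propositional using (Extensionality)
open import Axiom.DoubleNegationElimination using (DoubleNegationElimination; em⇒dne)
open import Data.Bool.Base using (Bool) renaming (T to IsTrue)
open import Data.Bool.Properties using (T-≡; ⇔→≡)
open import Data.Empty using (⊥-elim)
open import Data.Product.Base using (∃-syntax; _×_; _,_; proj₁; proj₂)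
open import Data.Sum.Base using (_⊎_; inj₁; inj₂; [_,_]′)
open import Function.Base using (id; _∘_)
open import Function.Bundles using (mk⇔; Equivalence)
open import Level using (Level; Lift; lift; lower; _⊔_)
open import Relation.Binary.Lattice.Bundles using (Lattice)
open import Relation.Binary.PropositionalEquality.Core using (_≡_; subst)
open import Relation.Nullary.Decidable.Core using (yes; no; ⌊_⌋; toWitness; fromWitness)
open import Relation.Nullary.Negation.Core using () renaming (¬_ to Not)
open import Relation.Unary using (Pred; _∈_; _∉_; _⊆_)
import Algebra.Lattice.Properties.BooleanAlgebra as BooleanAlgebraProperties
import Algebra.Lattice.Properties.Lattice as LatticeProperties
import Relation.Binary.Lattice.Properties.JoinSemilattice as JoinSemilatticeProperties

-- Zorn's lemma for families of subsets

-- Subsets are Bool-valued: by function extensionality, subsets with the same elements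
-- are then equal, so that the choice function cannot tell them apart, and a family of
-- subsets of A, whatever its level, has a union that is again a subset of A.
module Zorn
  (em : ∀ {p} → ExcludedMiddle p) (ext : ∀ {p q} → Extensionality p q)
  {a : Level} {A : Set a}
  where

  Subset : Set a
  Subset = A → Bool

  infix 4 _⊑_
  _⊑_ : Subset → Subset → Set a
  X ⊑ Y = ∀ x → IsTrue (X x) → IsTrue (Y x)

  ⊑-antisym : ∀ {X Y} → X ⊑ Y → Y ⊑ X → X ≡ Y
  ⊑-antisym X⊑Y Y⊑X = ext λ x → ⇔→≡ (mk⇔
    (Equivalence.to T-≡ ∘ X⊑Y x ∘ Equivalence.from T-≡)
    (Equivalence.to T-≡ ∘ Y⊑X x ∘ Equivalence.from T-≡))

  IsChain : ∀ {q} → Pred Subset q → Set (a ⊔ q)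
  IsChain C = ∀ {X Y} → X ∈ C → Y ∈ C → X ⊑ Y ⊎ Y ⊑ X

  module _ (B : Subset) where

    InUnion : (Subset → Bool) → Pred A a
    InUnion C x = IsTrue (B x) ⊎ (∃[ X ] IsTrue (C X) × IsTrue (X x))

    B∪⋃ : (Subset → Bool) → Subset
    B∪⋃ C x = ⌊ em {P = InUnion C x} ⌋

    ∈-⋃⁺ : ∀ C {x} → InUnion C x → IsTrue (B∪⋃ C x)
    ∈-⋃⁺ C = fromWitness

    ∈-⋃⁻ : ∀ C {x} → IsTrue (B∪⋃ C x) → InUnion C x
    ∈-⋃⁻ C = toWitness

    ⋃-upper : ∀ C {X} → IsTrue (C X) → X ⊑ B∪⋃ C
    ⋃-upper C X∈C x x∈X = ∈-⋃⁺ C (inj₂ (_ , X∈C , x∈X))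

    ⋃-least : ∀ C {Y} → B ⊑ Y → (∀ {X} → IsTrue (C X) → X ⊑ Y) → B∪⋃ C ⊑ Y
    ⋃-least C B⊑Y C⊑Y x x∈⋃ with ∈-⋃⁻ C x∈⋃
    ... | inj₁ x∈B             = B⊑Y x x∈B
    ... | inj₂ (X , X∈C , x∈X) = C⊑Y X∈C x x∈X

    -- The Bourbaki-Witt tower

    module _ (f : Subset → Subset) (f-inflationary : ∀ X → X ⊑ f X) where

      -- The tower starts at `B`, which `sup` yields for the empty family.
      data Tower : Pred Subset a where
        step : ∀ {X} → Tower X → Tower (f X)
        sup  : ∀ C → (∀ {X} → IsTrue (C X) → Tower X) → Tower (B∪⋃ C)

      base-⊑ : ∀ {X} → Tower X → B ⊑ X
      base-⊑ (step {X} t) x x∈B = f-inflationary X x (base-⊑ t x x∈B)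
      base-⊑ (sup C _)    x x∈B = ∈-⋃⁺ C (inj₁ x∈B)

      -- The extreme elements of the Bourbaki-Witt argument; the alternative `Y ⊑ Z` encodes that
      -- `Z` is not strictly below `Y`.
      NoneBetween : Pred Subset a
      NoneBetween Y = ∀ {Z} → Tower Z → Z ⊑ Y → Y ⊑ Z ⊎ f Z ⊑ Y

      -- Induction on `X`: a union either has a member above `f Y`, or all its members lie below
      -- `Y`.
      noneBetween⇒comparable : ∀ {Y} → Tower Y → NoneBetween Y →
                               ∀ {X} → Tower X → X ⊑ Y ⊎ f Y ⊑ X
      noneBetween⇒comparable tY gap (step {X} tX) with noneBetween⇒comparable tY gap tX
      ... | inj₂ fY⊑X = inj₂ λ x → f-inflationary X x ∘ fY⊑X x
      ... | inj₁ X⊑Y with gap tX X⊑Y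
      ...   | inj₂ fX⊑Y = inj₁ fX⊑Y
      -- `f` is only known to be inflationary, so `f Y ⊑ f X` comes from the equality of `X` and
      -- `Y`.
      ...   | inj₁ Y⊑X  = inj₂ λ x → subst (λ W → IsTrue (f W x)) (⊑-antisym Y⊑X X⊑Y)
      noneBetween⇒comparable {Y} tY gap (sup C C⊆Tower)
        with em {P = ∃[ X ] IsTrue (C X) × f Y ⊑ X}
      ... | yes (X , X∈C , fY⊑X) = inj₂ λ x → ⋃-upper C X∈C x ∘ fY⊑X x
      ... | no none = inj₁ (⋃-least C (base-⊑ tY) λ X∈C →
        [ id , (λ fY⊑X → ⊥-elim (none (_ , X∈C , fY⊑X))) ]′
          (noneBetween⇒comparable tY gap (C⊆Tower X∈C)))

      -- Induction on `Y`: the induction hypothesis makes the earlier stages comparable with every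
      -- `Z` in the tower.
      tower-noneBetween : ∀ {Y} → Tower Y → NoneBetween Y
      tower-noneBetween (step {Y} tY) tZ Z⊑fY
        with noneBetween⇒comparable tY (tower-noneBetween tY) tZ
      ... | inj₂ fY⊑Z = inj₁ fY⊑Z
      ... | inj₁ Z⊑Y with tower-noneBetween tY tZ Z⊑Y
      ...   | inj₂ fZ⊑Y = inj₂ λ x → f-inflationary Y x ∘ fZ⊑Y x
      ...   | inj₁ Y⊑Z  = inj₂ λ x → subst (λ W → IsTrue (f W x)) (⊑-antisym Z⊑Y Y⊑Z)
      tower-noneBetween (sup C C⊆Tower) {Z} tZ Z⊑⋃
        with em {P = ∃[ X ] IsTrue (C X) × f Z ⊑ X}
      ... | yes (X , X∈C , fZ⊑X) = inj₂ λ x → ⋃-upper C X∈C x ∘ fZ⊑X x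
      -- No member of `C` contains `f Z`, so comparability and the induction hypothesis force every
      -- member below `Z`.
      ... | no none = inj₁ (⋃-least C (base-⊑ tZ) below)
        where
        below : ∀ {X} → IsTrue (C X) → X ⊑ Z
        below {X} X∈C
          with noneBetween⇒comparable (C⊆Tower X∈C) (tower-noneBetween (C⊆Tower X∈C)) tZ
        ... | inj₂ fX⊑Z = λ x → fX⊑Z x ∘ f-inflationary X x
        ... | inj₁ Z⊑X with tower-noneBetween (C⊆Tower X∈C) tZ Z⊑X
        ...   | inj₁ X⊑Z  = X⊑Z
        ...   | inj₂ fZ⊑X = ⊥-elim (none (X , X∈C , fZ⊑X))

      tower-isChain : IsChain Tower
      tower-isChain {X} {Y} tX tY
        with noneBetween⇒comparable tY (tower-noneBetween tY) tX
      ... | inj₁ X⊑Y  = inj₁ X⊑Y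
      ... | inj₂ fY⊑X = inj₂ λ x → fY⊑X x ∘ f-inflationary Y x

    -- Maximal good subsets

    module _ {g : Level} (Good : Pred Subset g)
      (⋃-good : ∀ C → IsChain (IsTrue ∘ C) → (∀ {X} → IsTrue (C X) → B ⊑ X × Good X) →
                Good (B∪⋃ C))
      where

      private
        Extension : Subset → Set (a ⊔ g)
        Extension X = ∃[ Y ] Good Y × X ⊑ Y × Not (Y ⊑ X)

        extend : Subset → Subset
        extend X with em {P = Extension X}
        ... | yes (Y , _) = Y
        -- This default makes the fixed sets exactly those without a proper good extension.
        ... | no _        = X

        extend-inflationary : ∀ X → X ⊑ extend X
        extend-inflationary X with em {P = Extension X}
        ... | yes (_ , _ , X⊑Y , _) = X⊑Y
        ... | no _                  = λ _ → id

        extend-good : ∀ {X} → Good X → Good (extend X)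
        extend-good {X} good with em {P = Extension X}
        ... | yes (_ , goodY , _) = goodY
        ... | no _                = good

        extend-fixed⇒maximal : ∀ {X} → extend X ⊑ X → Not (Extension X)
        extend-fixed⇒maximal {X} fixed with em {P = Extension X}
        ... | yes (_ , _ , _ , Y⋢X) = λ _ → Y⋢X fixed
        ... | no none               = none

        𝕋 : Pred Subset a
        𝕋 = Tower extend extend-inflationary

        -- Families inside the tower are chains, so `⋃-good` applies; its empty case makes `B` good.
        tower-good : ∀ {X} → 𝕋 X → Good X
        tower-good (step t)        = extend-good (tower-good t)
        tower-good (sup C C⊆Tower) = ⋃-good C
          (λ X∈C Y∈C → tower-isChain _ _ (C⊆Tower X∈C) (C⊆Tower Y∈C))
          (λ X∈C → base-⊑ _ _ (C⊆Tower X∈C) , tower-good (C⊆Tower X∈C))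

        C : Subset → Bool
        C X = ⌊ em {P = 𝕋 X} ⌋

        M∈Tower : 𝕋 (B∪⋃ C)
        M∈Tower = sup C toWitness

      -- The union of the whole tower is in the tower, hence so is its `extend`, which therefore
      -- lies inside that union.
      maximal-extension : ∃[ M ] Good M × B ⊑ M × (∀ Y → Good Y → M ⊑ Y → Y ⊑ M)
      maximal-extension = B∪⋃ C , tower-good M∈Tower , base-⊑ _ _ M∈Tower ,
        λ Y goodY M⊑Y → em⇒dne em λ Y⋢M →
          extend-fixed⇒maximal (⋃-upper C (fromWitness (step M∈Tower))) (Y , goodY , M⊑Y , Y⋢M)

module Stone
  (em : ∀ {p} → ExcludedMiddle p) (ext : ∀ {p q} → Extensionality p q)
  {c ℓ : Level} (𝐀 : ConditionalAlgebra c ℓ)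
  where

  open ConditionalAlgebra 𝐀
  open BooleanAlgebraProperties booleanAlgebra
    using (∧-identityʳ; ∨-identityʳ; ∨-zeroʳ)
  open LatticeProperties lattice using (∨-∧-orderTheoreticLattice)
  open Lattice ∨-∧-orderTheoreticLattice
    using (antisym; x≤x∨y; y≤x∨y; x∧y≤x; x∧y≤y; ∧-greatest; joinSemilattice)
    renaming (refl to ≤-refl; trans to ≤-trans; reflexive to ≤-reflexive)
  open JoinSemilatticeProperties joinSemilattice using (∨-monotonic; x≤y⇒x∨y≈y)
  open IsFilter
  open Ul using (member)

  private
    p : Level
    p = c ⊔ ℓ

    dne : ∀ {q} → DoubleNegationElimination q
    dne = em⇒dne em

    variable
      F : Pred Carrier p
      x y z : Carrier

  -- Order and filters

  ⊤-greatest : ∀ x → x ≤ ⊤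
  ⊤-greatest x = sym (∧-identityʳ x)

  ⇒-monoʳ : ∀ x → y ≤ z → (x ⇒ y) ≤ (x ⇒ z)
  ⇒-monoʳ {y} {z} x y≤z = trans (⇒-cong refl y≤z) (sym (⇒-∧ x y z))

  ⇒-antiˡ : ∀ z → x ≤ y → (y ⇒ z) ≤ (x ⇒ z)
  ⇒-antiˡ {x} {y} z x≤y = ≤-trans
    (≤-reflexive (⇒-cong (sym (x≤y⇒x∨y≈y x≤y)) refl))
    (≤-trans (∨-⇒ x y z) (x∧y≤x _ _))

  ↑ : Carrier → Pred Carrier p
  ↑ a x = Lift p (a ≤ x)

  ↑-isFilter : ∀ a → IsFilter 𝐀 (↑ a)
  ↑-isFilter a = record
    { ⊤-mem    = lift (⊤-greatest a)
    ; ∧-closed = λ (lift a≤x) (lift a≤y) → lift (∧-greatest a≤x a≤y)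
    ; ≤-closed = λ x≤y (lift a≤x) → lift (≤-trans a≤x x≤y)
    }

  -- The filter generated by F and ¬ a.
  adjoin¬ : Carrier → Pred Carrier p → Pred Carrier p
  adjoin¬ a F x = (a ∨ x) ∈ F

  ⊆-adjoin¬ : IsFilter 𝐀 F → ∀ a → F ⊆ adjoin¬ a F
  ⊆-adjoin¬ filter a = ≤-closed filter (y≤x∨y a _)

  -- The map `a ∨_` preserves `⊤`, order and, by distributivity, meets, so it pulls filters back to
  -- filters. It sends `⊥` to `a`, whence properness.
  adjoin¬-isProperFilter : IsFilter 𝐀 F → ∀ {a} → a ∉ F → IsProperFilter 𝐀 (adjoin¬ a F)
  adjoin¬-isProperFilter filter {a} a∉F = record
    { isFilter = record
      { ⊤-mem    = ≤-closed filter (≤-reflexive (sym (∨-zeroʳ a))) (⊤-mem filter)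
      ; ∧-closed = λ x∈ y∈ →
          ≤-closed filter (≤-reflexive (sym (∨-distribˡ-∧ a _ _))) (∧-closed filter x∈ y∈)
      ; ≤-closed = λ x≤y → ≤-closed filter (∨-monotonic ≤-refl x≤y)
      }
    ; proper = λ a∨⊥∈F → a∉F (≤-closed filter (≤-reflexive (∨-identityʳ a)) a∨⊥∈F)
    }

  -- The ultrafilter theorem

  open Zorn em ext {A = Carrier}

  ⟪_⟫ : Subset → Pred Carrier p
  ⟪ X ⟫ x = Lift p (IsTrue (X x))

  IsProper : Pred Subset p
  IsProper X = IsProperFilter 𝐀 ⟪ X ⟫

  char : Pred Carrier p → Subset
  char F x = ⌊ em {P = F x} ⌋

  char-isProper : IsProperFilter 𝐀 F → IsProper (char F)
  char-isProper proper-F = record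
    { isFilter = record
      { ⊤-mem    = lift (fromWitness (⊤-mem isFilter))
      ; ∧-closed = λ (lift x∈) (lift y∈) →
          lift (fromWitness (∧-closed isFilter (toWitness x∈) (toWitness y∈)))
      ; ≤-closed = λ x≤y (lift x∈) → lift (fromWitness (≤-closed isFilter x≤y (toWitness x∈)))
      }
    ; proper = λ (lift ⊥∈) → proper (toWitness ⊥∈)
    }
    where open IsProperFilter proper-F

  -- Any two elements of the union lie in `B` or in a common member, because the members form a
  -- chain above `B`.
  ⋃-isProper : ∀ {B} → IsProper B → ∀ C → IsChain (IsTrue ∘ C) →
               (∀ {X} → IsTrue (C X) → B ⊑ X × IsProper X) → IsProper (B∪⋃ B C)
  ⋃-isProper {B} proper-B C chain member-C = record
    { isFilter = record
      { ⊤-mem    = lift (∈-⋃⁺ B C (inj₁ (lower (⊤-mem (isFilter proper-B)))))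
      ; ∧-closed = λ (lift x∈) (lift y∈) →
          lift (∈-⋃⁺ B C (meet (∈-⋃⁻ B C x∈) (∈-⋃⁻ B C y∈)))
      ; ≤-closed = λ x≤y (lift x∈) → lift (∈-⋃⁺ B C (upward x≤y (∈-⋃⁻ B C x∈)))
      }
    ; proper = λ (lift ⊥∈) → [ proper proper-B ∘ lift
                             , (λ (X , X∈C , ⊥∈X) → proper (proper-C X∈C) (lift ⊥∈X))
                             ]′ (∈-⋃⁻ B C ⊥∈)
    }
    where
    open IsProperFilter

    proper-C : ∀ {X} → IsTrue (C X) → IsProper X
    proper-C X∈C = proj₂ (member-C X∈C)

    meet∈ : ∀ {X} → IsProper X → IsTrue (X x) → IsTrue (X y) → IsTrue (X (x ∧ y))
    meet∈ proper-X x∈ y∈ = lower (∧-closed (isFilter proper-X) (lift x∈) (lift y∈))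

    upward∈ : ∀ {X} → IsProper X → x ≤ y → IsTrue (X x) → IsTrue (X y)
    upward∈ proper-X x≤y x∈ = lower (≤-closed (isFilter proper-X) x≤y (lift x∈))

    upward : x ≤ y → InUnion B C x → InUnion B C y
    upward x≤y (inj₁ x∈B)             = inj₁ (upward∈ proper-B x≤y x∈B)
    upward x≤y (inj₂ (X , X∈C , x∈X)) = inj₂ (X , X∈C , upward∈ (proper-C X∈C) x≤y x∈X)

    meet : InUnion B C x → InUnion B C y → InUnion B C (x ∧ y)
    meet (inj₁ x∈B) (inj₁ y∈B) = inj₁ (meet∈ proper-B x∈B y∈B)
    meet (inj₁ x∈B) (inj₂ (Y , Y∈C , y∈Y)) =
      inj₂ (Y , Y∈C , meet∈ (proper-C Y∈C) (proj₁ (member-C Y∈C) _ x∈B) y∈Y)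
    meet (inj₂ (X , X∈C , x∈X)) (inj₁ y∈B) =
      inj₂ (X , X∈C , meet∈ (proper-C X∈C) x∈X (proj₁ (member-C X∈C) _ y∈B))
    meet (inj₂ (X , X∈C , x∈X)) (inj₂ (Y , Y∈C , y∈Y)) with chain X∈C Y∈C
    ... | inj₁ X⊑Y = inj₂ (Y , Y∈C , meet∈ (proper-C Y∈C) (X⊑Y _ x∈X) y∈Y)
    ... | inj₂ Y⊑X = inj₂ (X , X∈C , meet∈ (proper-C X∈C) x∈X (Y⊑X _ y∈Y))

  ultrafilter-extension : IsProperFilter 𝐀 F → ∃[ u ] F ⊆ member {𝐀 = 𝐀} u
  ultrafilter-extension {F} proper-F
    with maximal-extension (char F) IsProper (⋃-isProper (char-isProper proper-F))
  ... | M , proper-M , F⊑M , maximal-M = record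
    { member        = ⟪ M ⟫
    ; isUltrafilter = record
      { isProperFilter = proper-M
      -- A competitor `G` is an arbitrary predicate; `char G` brings it into the range of Zorn's
      -- lemma.
      ; maximal        = λ G proper-G M⊆G x∈G → lift (maximal-M (char G) (char-isProper proper-G)
          (λ _ x∈M → fromWitness (M⊆G (lift x∈M))) _ (fromWitness x∈G))
      }
    } , λ x∈F → lift (F⊑M _ (fromWitness x∈F))

  -- Prime ultrafilters and separation

  module _ (u : Ul 𝐀) where
    open IsUltrafilter (Ul.isUltrafilter u) using (isProperFilter; maximal)
    open IsProperFilter isProperFilter using (proper) renaming (isFilter to filter) public

    -- If `x ∉ u`, then `adjoin¬ x u` is a proper filter above `u`, so maximality puts it inside
    -- `u`; `y` belongs to it because `x ∨ y ∈ u`.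
    ∨-prime : (x ∨ y) ∈ member u → x ∈ member u ⊎ y ∈ member u
    ∨-prime {x} x∨y∈u with em {P = x ∈ member u}
    ... | yes x∈u = inj₁ x∈u
    ... | no  x∉u = inj₂ (maximal _ (adjoin¬-isProperFilter filter x∉u)
                                    (⊆-adjoin¬ filter x) x∨y∈u)

    consistent : x ∈ member u → (¬ x) ∉ member u
    consistent {x} x∈u ¬x∈u =
      proper (≤-closed filter (≤-reflexive (∧-complementʳ x)) (∧-closed filter x∈u ¬x∈u))

    complete : x ∉ member u → (¬ x) ∈ member u
    complete {x} x∉u = [ ⊥-elim ∘ x∉u , id ]′
      (∨-prime (≤-closed filter (≤-reflexive (sym (∨-complementʳ x))) (⊤-mem filter)))

  separation : IsFilter 𝐀 F → ∀ {a} → a ∉ F → ∃[ u ] F ⊆ member {𝐀 = 𝐀} u × a ∉ member u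
  separation {F} filter-F {a} a∉F
    with ultrafilter-extension (adjoin¬-isProperFilter filter-F a∉F)
  ... | u , adjoin⊆u = u , adjoin⊆u ∘ ⊆-adjoin¬ filter-F a , λ a∈u →
    consistent u a∈u (adjoin⊆u ¬a∈adjoin)
    where
    ¬a∈adjoin : (¬ a) ∈ adjoin¬ a F
    ¬a∈adjoin = ≤-closed filter-F (≤-reflexive (sym (∨-complementʳ a))) (⊤-mem filter-F)

  -- Contrapositive of separation: a filter is the intersection of the ultrafilters above it, an
  -- empty intersection for the improper filter.
  φᶠ⊆φ⇒∈ : IsFilter 𝐀 F → ∀ {a} → φᶠ 𝐀 F ⊆ φ 𝐀 a → a ∈ F
  φᶠ⊆φ⇒∈ filter φF⊆φa = dne λ a∉F →
    let u , F⊆u , a∉u = separation filter a∉F in a∉u (φF⊆φa {u} F⊆u)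

  φ-reflects-≤ : φ 𝐀 x ⊆ φ 𝐀 y → x ≤ y
  φ-reflects-≤ {x} φx⊆φy =
    lower (φᶠ⊆φ⇒∈ (↑-isFilter x) λ {u} ↑x⊆u → φx⊆φy {u} (↑x⊆u (lift ≤-refl)))

  -- The conditional

  module _ (u : Ul 𝐀) where
    -- `_⇒_` is antitone on the left, so a witness above `a` can be replaced by `a`.
    ∈-D-↑⁻ : ∀ {a b} → b ∈ D 𝐀 (member u) (↑ a) → (a ⇒ b) ∈ member u
    ∈-D-↑⁻ {b = b} (_ , lift a≤a′ , a′⇒b∈u) = ≤-closed (filter u) (⇒-antiˡ b a≤a′) a′⇒b∈u

    ∈-D-↑⁺ : ∀ {a b} → (a ⇒ b) ∈ member u → b ∈ D 𝐀 (member u) (↑ a)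
    ∈-D-↑⁺ a⇒b∈u = _ , lift ≤-refl , a⇒b∈u

    -- As the set of `x` with `a ⇒ x ∈ u`, it is the preimage of `u` under a map preserving `⊤`,
    -- meets and order.
    D-↑-isFilter : ∀ a → IsFilter 𝐀 (D 𝐀 (member u) (↑ a))
    D-↑-isFilter a = record
      { ⊤-mem    = ∈-D-↑⁺ (≤-closed (filter u) (≤-reflexive (sym (⇒-⊤ a))) (⊤-mem (filter u)))
      ; ∧-closed = λ x∈ y∈ → ∈-D-↑⁺ (≤-closed (filter u) (≤-reflexive (⇒-∧ a _ _))
                                       (∧-closed (filter u) (∈-D-↑⁻ x∈) (∈-D-↑⁻ y∈)))
      ; ≤-closed = λ x≤y x∈ → ∈-D-↑⁺ (≤-closed (filter u) (⇒-monoʳ a x≤y) (∈-D-↑⁻ x∈))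
      }

    ⇒-sound : ∀ {a b} → u ∈ φ 𝐀 (a ⇒ b) → u ∈ _⇒ᵀ_ 𝐀 (φ 𝐀 a) (φ 𝐀 b)
    ⇒-sound a⇒b∈u Z Z⊆φa (F , filter-F , (_ , φF⊆Z) , D⊆v) =
      -- The witness for `b ∈ D u F` is `a` itself.
      D⊆v (_ , φᶠ⊆φ⇒∈ filter-F (λ {w} F⊆w → Z⊆φa {w} (φF⊆Z {w} F⊆w)) , a⇒b∈u)

    -- Testing the hypothesis on `φᶠ (↑ a)` puts `b` in every ultrafilter above `D u (↑ a)`, hence
    -- in that filter.
    ⇒-complete : ∀ {a b} → u ∈ _⇒ᵀ_ 𝐀 (φ 𝐀 a) (φ 𝐀 b) → u ∈ φ 𝐀 (a ⇒ b)
    ⇒-complete {a} u∈φa⇒φb = ∈-D-↑⁻ (φᶠ⊆φ⇒∈ (D-↑-isFilter a) λ {v} D⊆v →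
      u∈φa⇒φb (φᶠ 𝐀 (↑ a)) (λ ↑a⊆w → ↑a⊆w (lift ≤-refl)) {v}
        (↑ a , ↑-isFilter a , (id , id) , D⊆v))

  -- The Stone embedding

  φ-isEmbedding : IsEmbedding 𝐀 (φ 𝐀)
  φ-isEmbedding = record
    { isLatticeMonomorphism = record
      { isLatticeHomomorphism = record
        { isRelHomomorphism = record
          { cong = λ x≈y → (λ {u} → ≤-closed (filter u) (≤-reflexive x≈y))
                         , (λ {u} → ≤-closed (filter u) (≤-reflexive (sym x≈y)))
          }
        ; ∧-homo = λ x y →
            (λ {u} x∧y∈u → ≤-closed (filter u) (x∧y≤x x y) x∧y∈u
                         , ≤-closed (filter u) (x∧y≤y x y) x∧y∈u)
          , (λ {u} (x∈u , y∈u) → ∧-closed (filter u) x∈u y∈u)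
        ; ∨-homo = λ x y →
            (λ {u} → ∨-prime u)
          , (λ {u} → [ ≤-closed (filter u) (x≤x∨y x y) , ≤-closed (filter u) (y≤x∨y x y) ]′)
        }
      ; injective = λ (φx⊆φy , φy⊆φx) →
          antisym (φ-reflects-≤ λ {u} → φx⊆φy {u}) (φ-reflects-≤ λ {u} → φy⊆φx {u})
      }
    ; ⊤-homo = _ , (λ {u} _ → ⊤-mem (filter u))
    ; ⊥-homo = (λ {u} ⊥∈u → ⊥-elim (proper u ⊥∈u)) , λ ()
    ; ¬-homo = λ a → (λ {u} ¬a∈u a∈u → consistent u a∈u ¬a∈u) , (λ {u} → complete u)
    ; ⇒-homo = λ a b → (λ {u} → ⇒-sound u) , (λ {u} → ⇒-complete u)
    }

theorem2p10 : (∀ {p} → ExcludedMiddle p) → (∀ {p q} → Extensionality p q) →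
    ∀ {c ℓ} (𝐀 : ConditionalAlgebra c ℓ) → IsEmbedding 𝐀 (φ 𝐀)
theorem2p10 em ext 𝐀 = Stone.φ-isEmbedding em ext 𝐀
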